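{- Let $u\ge \ell\ge 1$ be integers, let $n\coloneqq 2^\ell$, and let $\mathcal{H}$ be the set of all linear maps $\mathbb{F}_2^u\to\mathbb{F}_2^\ell$. For any $S\subset \mathbb{F}_2^u$ of cardinality $n$, if $h$ is drawn uniformly at random from $\mathcal{H}$, then \[\mathbb{E}_{h\sim \mathcal{H}}\left[\max_{y\in \mathbb{F}_2^\ell} |h^{ -1}(y)\cap S|\right] \le \frac{16\log n}{\log\log n}.\]
   Context: $\log$ denotes the base-2 logarithm. $\mathbb{F}_2$ is the field with two elements. -}

module Defs where

open import Data.Bool using (Bool; true; false; _∧_; _xor_)
open import Data.Bool.Properties using () renaming (_≟_ to _≟B_)
open import Data.Nat using (ℕ; zero; suc; _⊔_)
open import Data.List using (List; []; _∷_; [_]; concatMap; map; foldr; filter; length)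
open import Data.Nat.ListAction using (sum)
open import Data.Vec using (Vec; []; _∷_; zipWith)
import Data.Vec as V
open import Data.Vec.Properties using (≡-dec)

-- 𝔽₂ is represented by Bool (false = 0, true = 1; addition = xor, multiplication = ∧).
-- 𝔽₂^k is Vec Bool k.

allVecsOf : {A : Set} → List A → (k : ℕ) → List (Vec A k)
allVecsOf xs zero    = [ [] ]
allVecsOf xs (suc k) = concatMap (λ v → map (λ a → a ∷ v) xs) (allVecsOf xs k)

allVecs : (k : ℕ) → List (Vec Bool k)
allVecs = allVecsOf (false ∷ true ∷ [])

-- A linear map 𝔽₂^u → 𝔽₂^ℓ is represented by its ℓ × u matrix (list of ℓ rows).
Mat : ℕ → ℕ → Set
Mat ℓ u = Vec (Vec Bool u) ℓ

-- the set 𝓗 of all linear maps 𝔽₂^u → 𝔽₂^ℓ, enumerated (each exactly once)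
allMats : (ℓ u : ℕ) → List (Mat ℓ u)
allMats ℓ u = allVecsOf (allVecs u) ℓ

dot : {u : ℕ} → Vec Bool u → Vec Bool u → Bool
dot r x = V.foldr _ _xor_ false (zipWith _∧_ r x)

apply : {ℓ u : ℕ} → Mat ℓ u → Vec Bool u → Vec Bool ℓ
apply M x = V.map (λ r → dot r x) M

load : {ℓ u : ℕ} → Mat ℓ u → List (Vec Bool u) → Vec Bool ℓ → ℕ
load M S y = length (filter (λ x → ≡-dec _≟B_ (apply M x) y) S)

maxLoad : {ℓ u : ℕ} → Mat ℓ u → List (Vec Bool u) → ℕ
maxLoad {ℓ} M S = foldr _⊔_ 0 (map (load M S) (allVecs ℓ))

-- Σ_{h ∈ 𝓗} max_y |h⁻¹(y) ∩ S|   (so 𝔼 = totalMaxLoad / |𝓗|, |𝓗| = 2^(ℓu))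
totalMaxLoad : (ℓ u : ℕ) → List (Vec Bool u) → ℕ
totalMaxLoad ℓ u S = sum (map (λ M → maxLoad M S) (allMats ℓ u))

{-# OPTIONS --safe #-}
-- Write N = 2^ℓ and, for F : 𝔽₂^u → 𝔽₂^ℓ → ℕ, Z(F,M) = Σ_y ∏_x F(x, y + Mx).
-- Build a uniformly random matrix M column by column.  Exposing a column c
-- replaces F by F_c(x,z) = F(0x,z) · F(1x,z+c), and the average over c of
-- Σ_y F_c(x,y) / N is (Σ_y F(0x,y) / N) · (Σ_y F(1x,y) / N).  By AM–GM over c
-- the geometric mean of ∏_x (Σ_y F_c(x,y) / N) is therefore at most
-- ∏_x (Σ_y F(x,y) / N), and by induction the geometric mean over M of Z(F,M) / N
-- obeys the same bound.
-- For F(x,z) = ℓ^([x ∈ S]·[z = 0]) we have ℓ^maxLoad ≤ Z(F,M), whereas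
-- ∏_x (Σ_y F(x,y) / N) = (1 + (ℓ-1)/N)^N ≤ 4^(ℓ-1); hence the geometric mean
-- of ℓ^maxLoad is at most N · 4^(ℓ-1) ≤ 2^(3ℓ).
module Submission where

open import Defs
open import Algebra.Structures using (IsCommutativeMonoid)
open import Data.Bool using (Bool; true; false; _xor_; if_then_else_)
open import Data.Bool.Properties using (xor-assoc; xor-comm; ∧-identityʳ; ∧-zeroʳ) renaming (_≟_ to _≟B_)
open import Data.List using (List; []; _∷_; _++_; concatMap; foldr; length; map)
open import Data.List.Relation.Unary.All using (All; []; _∷_)
open import Data.List.Relation.Unary.AllPairs using ([]; _∷_)
open import Data.List.Relation.Unary.Unique.Propositional using (Unique)
open import Data.Nat using (ℕ; zero; suc; _≤_; _+_; _*_; _^_; _⊔_; z≤n; s≤s)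
open import Data.Nat.Properties
open import Data.Nat.Tactic.RingSolver using (solve-∀)
open import Data.Product using (_,_)
open import Data.Sum using (inj₁; inj₂)
open import Data.Vec using (Vec; []; _∷_; replicate; zipWith)
open import Data.Vec.Properties using (≡-dec; zipWith-assoc; zipWith-comm)
open import Relation.Binary.PropositionalEquality using (_≡_; _≢_; refl; sym; trans; cong; cong₂; subst; module ≡-Reasoning)
open import Relation.Nullary using (yes; no; contradiction)

-- Big operators over lists

module BigOp {_∙_ : ℕ → ℕ → ℕ} {ε : ℕ} (isCM : IsCommutativeMonoid _≡_ _∙_ ε) where
  open IsCommutativeMonoid isCM using (assoc; comm; identityˡ; identityʳ)

  -- `foldr` after `map` is also the shape of `totalMaxLoad` and `maxLoad`, so the additive instance
  -- matches `totalMaxLoad` by computation. The commutative monoid is a parameter because every law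
  -- is used for both sums and products.
  big : {A : Set} → List A → (A → ℕ) → ℕ
  big xs f = foldr _∙_ ε (map f xs)

  interchange : ∀ a b c d → (a ∙ b) ∙ (c ∙ d) ≡ (a ∙ c) ∙ (b ∙ d)
  interchange a b c d = begin
    (a ∙ b) ∙ (c ∙ d)  ≡⟨ assoc a b (c ∙ d) ⟩
    a ∙ (b ∙ (c ∙ d))  ≡⟨ cong (a ∙_) (sym (assoc b c d)) ⟩
    a ∙ ((b ∙ c) ∙ d)  ≡⟨ cong (λ t → a ∙ (t ∙ d)) (comm b c) ⟩
    a ∙ ((c ∙ b) ∙ d)  ≡⟨ cong (a ∙_) (assoc c b d) ⟩
    a ∙ (c ∙ (b ∙ d))  ≡⟨ assoc a c (b ∙ d) ⟨
    (a ∙ c) ∙ (b ∙ d)  ∎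
    where open ≡-Reasoning

  big-cong : {A : Set} (xs : List A) {f g : A → ℕ} → (∀ x → f x ≡ g x) → big xs f ≡ big xs g
  big-cong []       eq = refl
  big-cong (x ∷ xs) eq = cong₂ _∙_ (eq x) (big-cong xs eq)

  big-ε : {A : Set} (xs : List A) → big xs (λ _ → ε) ≡ ε
  big-ε []       = refl
  big-ε (x ∷ xs) = trans (identityˡ _) (big-ε xs)

  big-∙ : {A : Set} (xs : List A) (f g : A → ℕ) → big xs (λ x → f x ∙ g x) ≡ big xs f ∙ big xs g
  big-∙ []       f g = sym (identityˡ ε)
  big-∙ (x ∷ xs) f g = trans (cong ((f x ∙ g x) ∙_) (big-∙ xs f g)) (interchange (f x) (g x) _ _)

  big-swap : {A B : Set} (xs : List A) (ys : List B) (f : A → B → ℕ) →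
    big xs (λ x → big ys (f x)) ≡ big ys (λ y → big xs (λ x → f x y))
  big-swap []       ys f = sym (big-ε ys)
  big-swap (x ∷ xs) ys f = trans (cong (big ys (f x) ∙_) (big-swap xs ys f)) (sym (big-∙ ys (f x) _))

  big-++ : {A : Set} (xs ys : List A) (f : A → ℕ) → big (xs ++ ys) f ≡ big xs f ∙ big ys f
  big-++ []       ys f = sym (identityˡ _)
  big-++ (x ∷ xs) ys f = trans (cong (f x ∙_) (big-++ xs ys f)) (sym (assoc _ _ _))

  big-map : {A B : Set} (h : A → B) (xs : List A) (f : B → ℕ) → big (map h xs) f ≡ big xs (λ x → f (h x))
  big-map h []       f = refl
  big-map h (x ∷ xs) f = cong (f (h x) ∙_) (big-map h xs f)

  big-concatMap : {A B : Set} (h : A → List B) (xs : List A) (f : B → ℕ) →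
    big (concatMap h xs) f ≡ big xs (λ x → big (h x) f)
  big-concatMap h []       f = refl
  big-concatMap h (x ∷ xs) f =
    trans (big-++ (h x) (concatMap h xs) f) (cong (big (h x) f ∙_) (big-concatMap h xs f))

  big-allVecsOf-suc : {A : Set} (xs : List A) (k : ℕ) (f : Vec A (suc k) → ℕ) →
    big (allVecsOf xs (suc k)) f ≡ big (allVecsOf xs k) (λ v → big xs (λ a → f (a ∷ v)))
  big-allVecsOf-suc xs k f =
    trans (big-concatMap _ (allVecsOf xs k) f) (big-cong (allVecsOf xs k) (λ v → big-map (_∷ v) xs f))

  big-allVecs-suc : (k : ℕ) (f : Vec Bool (suc k) → ℕ) →
    big (allVecs (suc k)) f ≡ big (allVecs k) (λ v → f (false ∷ v) ∙ f (true ∷ v))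
  big-allVecs-suc k f = trans (big-allVecsOf-suc _ k f)
    (big-cong (allVecs k) (λ v → cong (f (false ∷ v) ∙_) (identityʳ _)))

  -- `allMats` enumerates by rows, while the main induction exposes columns. Induction on the rows:
  -- the first entry of each row is moved into `c`, and commutativity permits the reordering.
  big-allMats-suc : (ℓ u : ℕ) (f : Mat ℓ (suc u) → ℕ) →
    big (allMats ℓ (suc u)) f ≡ big (allVecs ℓ) (λ c → big (allMats ℓ u) (λ M → f (zipWith _∷_ c M)))
  big-allMats-suc zero    u f = sym (identityʳ _)
  big-allMats-suc (suc ℓ) u f = begin
    big (allMats (suc ℓ) (suc u)) f
      ≡⟨ big-allVecsOf-suc (allVecs (suc u)) ℓ f ⟩
    big (allMats ℓ (suc u)) (λ M → big (allVecs (suc u)) (λ r → f (r ∷ M)))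
      ≡⟨ big-cong (allMats ℓ (suc u)) (λ M → trans (big-allVecs-suc u _) (big-∙ (allVecs u) _ _)) ⟩
    big (allMats ℓ (suc u)) (λ M → row false M ∙ row true M)
      -- The top row has been split into its first bit and its tail; the induction hypothesis now
      -- splits off the first column of the remaining rows.
      ≡⟨ big-allMats-suc ℓ u _ ⟩
    big (allVecs ℓ) (λ c → big (allMats ℓ u) (λ M → row false (zipWith _∷_ c M) ∙ row true (zipWith _∷_ c M)))
      ≡⟨ big-cong (allVecs ℓ) (λ c → trans (big-∙ (allMats ℓ u) _ _)
           (sym (cong₂ _∙_ (big-allVecsOf-suc (allVecs u) ℓ _) (big-allVecsOf-suc (allVecs u) ℓ _)))) ⟩
    big (allVecs ℓ) (λ c → g (false ∷ c) ∙ g (true ∷ c))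
      ≡⟨ big-allVecs-suc ℓ g ⟨
    big (allVecs (suc ℓ)) g ∎
    where
    open ≡-Reasoning
    row : Bool → Mat ℓ (suc u) → ℕ
    row b M = big (allVecs u) (λ v → f ((b ∷ v) ∷ M))
    g : Vec Bool (suc ℓ) → ℕ
    g c = big (allMats (suc ℓ) u) (λ M → f (zipWith _∷_ c M))

  big-allMats-zero : (ℓ : ℕ) (f : Mat ℓ 0 → ℕ) → big (allMats ℓ 0) f ≡ f (replicate ℓ [])
  big-allMats-zero zero    f = identityʳ _
  big-allMats-zero (suc ℓ) f =
    trans (big-allVecsOf-suc (allVecs 0) ℓ f) (trans (big-allMats-zero ℓ _) (identityʳ _))

open BigOp +-0-isCommutativeMonoid using () renaming
  ( big to ∑; big-cong to ∑-cong; big-∙ to ∑-+; big-swap to ∑-swap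
  ; big-allVecs-suc to ∑-allVecs-suc )
open BigOp *-1-isCommutativeMonoid using () renaming
  ( big to ∏; big-cong to ∏-cong; big-∙ to ∏-*; big-swap to ∏-swap
  ; big-allVecs-suc to ∏-allVecs-suc; big-allMats-suc to ∏-allMats-suc
  ; big-allMats-zero to ∏-allMats-zero )

-- Powers, products and sums over lists.

^-distribʳ-* : ∀ a b n → (a * b) ^ n ≡ a ^ n * b ^ n
^-distribʳ-* a b zero    = refl
^-distribʳ-* a b (suc n) =
  trans (cong (a * b *_) (^-distribʳ-* a b n)) (*-interchange a b (a ^ n) (b ^ n))
  where
  *-interchange : ∀ a b c d → a * b * (c * d) ≡ a * c * (b * d)
  *-interchange = solve-∀

∏-mono : {A : Set} (xs : List A) {f g : A → ℕ} → (∀ x → f x ≤ g x) → ∏ xs f ≤ ∏ xs g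
∏-mono []       le = ≤-refl
∏-mono (x ∷ xs) le = *-mono-≤ (le x) (∏-mono xs le)

∏-^ : {A : Set} (xs : List A) (f : A → ℕ) (n : ℕ) → ∏ xs (λ x → f x ^ n) ≡ ∏ xs f ^ n
∏-^ []       f n = sym (^-zeroˡ n)
∏-^ (x ∷ xs) f n = trans (cong (f x ^ n *_) (∏-^ xs f n)) (sym (^-distribʳ-* (f x) _ n))

∏-base-^ : {A : Set} (b : ℕ) (xs : List A) (f : A → ℕ) → ∏ xs (λ x → b ^ f x) ≡ b ^ ∑ xs f
∏-base-^ b []       f = refl
∏-base-^ b (x ∷ xs) f = trans (cong (b ^ f x *_) (∏-base-^ b xs f)) (sym (^-distribˡ-+-* b (f x) _))

∑-*ˡ : {A : Set} (a : ℕ) (xs : List A) (f : A → ℕ) → ∑ xs (λ x → a * f x) ≡ a * ∑ xs f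
∑-*ˡ a []       f = sym (*-zeroʳ a)
∑-*ˡ a (x ∷ xs) f = trans (cong (a * f x +_) (∑-*ˡ a xs f)) (sym (*-distribˡ-+ a (f x) _))

∑-*ʳ : {A : Set} (xs : List A) (f : A → ℕ) (a : ℕ) → ∑ xs (λ x → f x * a) ≡ ∑ xs f * a
∑-*ʳ xs f a = trans (∑-cong xs (λ x → *-comm (f x) a)) (trans (∑-*ˡ a xs f) (*-comm a _))

∑-one : {A : Set} (xs : List A) → ∑ xs (λ _ → 1) ≡ length xs
∑-one []       = refl
∑-one (x ∷ xs) = cong suc (∑-one xs)

∑-allVecs-const : (k a : ℕ) → ∑ (allVecs k) (λ _ → a) ≡ a * 2 ^ k
∑-allVecs-const zero    a = trans (+-identityʳ a) (sym (*-identityʳ a))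
∑-allVecs-const (suc k) a = trans (∑-allVecs-suc k _) (trans (∑-allVecs-const k (a + a)) (lemma a (2 ^ k)))
  where
  lemma : ∀ a n → (a + a) * n ≡ a * (2 * n)
  lemma = solve-∀

∏-allVecs-const : (k a : ℕ) → ∏ (allVecs k) (λ _ → a) ≡ a ^ 2 ^ k
∏-allVecs-const k a = begin
  ∏ (allVecs k) (λ _ → a)        ≡⟨ ∏-cong (allVecs k) (λ _ → sym (^-identityʳ a)) ⟩
  ∏ (allVecs k) (λ _ → a ^ 1)    ≡⟨ ∏-base-^ a (allVecs k) (λ _ → 1) ⟩
  a ^ ∑ (allVecs k) (λ _ → 1)    ≡⟨ cong (a ^_) (trans (∑-allVecs-const k 1) (*-identityˡ _)) ⟩
  a ^ 2 ^ k                      ∎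
  where open ≡-Reasoning

-- AM–GM and the exponential bound

-- The gap is the square of the difference `d` of the two numbers, obtained by ordering them first.
4ab≤[a+b]² : ∀ a b → 4 * (a * b) ≤ (a + b) ^ 2
4ab≤[a+b]² a b with ≤-total a b
... | inj₁ a≤b with d , refl ← m≤n⇒∃[o]m+o≡n a≤b = subst (4 * (a * (a + d)) ≤_) (eq a d) (m≤m+n _ (d * d))
  where
  eq : ∀ a d → 4 * (a * (a + d)) + d * d ≡ (a + (a + d)) * ((a + (a + d)) * 1)
  eq = solve-∀
... | inj₂ b≤a with d , refl ← m≤n⇒∃[o]m+o≡n b≤a = subst (4 * ((b + d) * b) ≤_) (eq b d) (m≤m+n _ (d * d))
  where
  eq : ∀ b d → 4 * ((b + d) * b) + d * d ≡ (b + d + b) * ((b + d + b) * 1)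
  eq = solve-∀

-- Cauchy's doubling argument: pair the values by the first bit, use `4ab≤[a+b]²` on each pair, then
-- apply the case `k` to the pair sums and square it.
am-gm : (k : ℕ) (f : Vec Bool k → ℕ) →
  ∏ (allVecs k) f * (2 ^ k) ^ 2 ^ k ≤ ∑ (allVecs k) f ^ 2 ^ k
am-gm zero    f = ≤-reflexive (eq (f []))
  where
  eq : ∀ a → (a * 1) * 1 ≡ (a + 0) * 1
  eq = solve-∀
am-gm (suc k) f = begin
  ∏ (allVecs (suc k)) f * (2 * N) ^ (2 * N)
    ≡⟨ cong₂ _*_ (∏-allVecs-suc k f) pow ⟩
  ∏ (allVecs k) p * (4 ^ N * (N ^ N) ^ 2)
    ≡⟨ eq (∏ (allVecs k) p) (4 ^ N) ((N ^ N) ^ 2) ⟩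
  4 ^ N * ∏ (allVecs k) p * (N ^ N) ^ 2
    ≡⟨ cong (λ t → t * ∏ (allVecs k) p * (N ^ N) ^ 2) (∏-allVecs-const k 4) ⟨
  ∏ (allVecs k) (λ _ → 4) * ∏ (allVecs k) p * (N ^ N) ^ 2
    ≡⟨ cong (_* (N ^ N) ^ 2) (∏-* (allVecs k) (λ _ → 4) p) ⟨
  ∏ (allVecs k) (λ v → 4 * p v) * (N ^ N) ^ 2
    ≤⟨ *-monoˡ-≤ _ (∏-mono (allVecs k) (λ v → 4ab≤[a+b]² (f (false ∷ v)) (f (true ∷ v)))) ⟩
  ∏ (allVecs k) (λ v → s v ^ 2) * (N ^ N) ^ 2
    ≡⟨ cong (_* (N ^ N) ^ 2) (∏-^ (allVecs k) s 2) ⟩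
  ∏ (allVecs k) s ^ 2 * (N ^ N) ^ 2
    ≡⟨ ^-distribʳ-* (∏ (allVecs k) s) (N ^ N) 2 ⟨
  (∏ (allVecs k) s * N ^ N) ^ 2
    ≤⟨ ^-monoˡ-≤ 2 (am-gm k s) ⟩
  (∑ (allVecs k) s ^ N) ^ 2
    ≡⟨ ^-*-assoc (∑ (allVecs k) s) N 2 ⟩
  ∑ (allVecs k) s ^ (N * 2)
    ≡⟨ cong₂ _^_ (sym (∑-allVecs-suc k f)) (*-comm N 2) ⟩
  ∑ (allVecs (suc k)) f ^ (2 * N) ∎
  where
  open ≤-Reasoning
  N = 2 ^ k
  p s : Vec Bool k → ℕ
  p v = f (false ∷ v) * f (true ∷ v)
  s v = f (false ∷ v) + f (true ∷ v)
  pow : (2 * N) ^ (2 * N) ≡ 4 ^ N * (N ^ N) ^ 2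
  pow = trans (^-distribʳ-* 2 N (2 * N)) (cong₂ _*_ (sym (^-*-assoc 2 2 N))
    (trans (cong (N ^_) (*-comm 2 N)) (sym (^-*-assoc N N 2))))
  eq : ∀ a b c → a * (b * c) ≡ b * a * c
  eq = solve-∀

-- Bernoulli's inequality `(1 - 1/(m+1))^k ≥ 1 - k/(m+1)`, cleared of denominators and of
-- subtraction.
bernoulli : ∀ m k → suc m * suc m ^ k ≤ suc m * m ^ k + k * suc m ^ k
bernoulli m zero    = m≤m+n _ 0
bernoulli m (suc k) = begin
  suc m * (suc m * suc m ^ k)
    ≤⟨ *-monoʳ-≤ (suc m) (bernoulli m k) ⟩
  suc m * (suc m * m ^ k + k * suc m ^ k)
    ≡⟨ eq m (m ^ k) k (suc m ^ k) ⟩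
  suc m * (m * m ^ k) + k * (suc m * suc m ^ k) + suc m * m ^ k
    -- The leftover `suc m * m ^ k` is at most one more copy of `suc m ^ suc k`, which raises the
    -- coefficient `k` by one.
    ≤⟨ +-monoʳ-≤ (suc m * (m * m ^ k) + k * (suc m * suc m ^ k)) (*-monoʳ-≤ (suc m) (^-monoˡ-≤ k (n≤1+n m))) ⟩
  suc m * (m * m ^ k) + k * (suc m * suc m ^ k) + suc m * suc m ^ k
    ≡⟨ eq′ (suc m * (m * m ^ k)) k (suc m * suc m ^ k) ⟩
  suc m * (m * m ^ k) + suc k * (suc m * suc m ^ k) ∎
  where
  open ≤-Reasoning
  eq : ∀ m a k b → suc m * (suc m * a + k * b) ≡ suc m * (m * a) + k * (suc m * b) + suc m * a
  eq = solve-∀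
  eq′ : ∀ a k b → a + k * b + b ≡ a + suc k * b
  eq′ = solve-∀

-- Here `k/(m+1)` is at most 1/2, so Bernoulli bounds `(m/(m+1))^k` below by 1/2. A copy of
-- `suc m * p` is added to both sides and cancelled, in place of a subtraction.
[1+m]^k≤2m^k : ∀ m k → 2 * k ≤ suc m → suc m ^ k ≤ 2 * m ^ k
[1+m]^k≤2m^k m k 2k≤1+m = *-cancelˡ-≤ (suc m) (+-cancelʳ-≤ (suc m * p) _ _ (begin
  suc m * p + suc m * p            ≡⟨ eq (suc m * p) ⟩
  2 * (suc m * p)                  ≤⟨ *-monoʳ-≤ 2 (bernoulli m k) ⟩
  2 * (suc m * m ^ k + k * p)      ≡⟨ eq′ m (m ^ k) k p ⟩
  suc m * (2 * m ^ k) + 2 * k * p  ≤⟨ +-monoʳ-≤ _ (*-monoˡ-≤ p 2k≤1+m) ⟩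
  suc m * (2 * m ^ k) + suc m * p  ∎))
  where
  open ≤-Reasoning
  p = suc m ^ k
  eq : ∀ a → a + a ≡ 2 * a
  eq = solve-∀
  eq′ : ∀ m a k p → 2 * (suc m * a + k * p) ≡ suc m * (2 * a) + 2 * k * p
  eq′ = solve-∀

-- (1 + a/2k)^(2k) ≤ 4^a
[2k+a]^2k≤4^a[2k]^2k : ∀ k a → (2 * k + a) ^ (2 * k) ≤ 4 ^ a * (2 * k) ^ (2 * k)
[2k+a]^2k≤4^a[2k]^2k k zero    = ≤-reflexive
  (trans (cong (_^ (2 * k)) (+-identityʳ (2 * k))) (sym (*-identityˡ _)))
[2k+a]^2k≤4^a[2k]^2k k (suc a) = begin
  (2 * k + suc a) ^ (2 * k)          ≡⟨ cong₂ _^_ (+-suc (2 * k) a) (*-comm 2 k) ⟩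
  suc (2 * k + a) ^ (k * 2)          ≡⟨ ^-*-assoc (suc (2 * k + a)) k 2 ⟨
  (suc (2 * k + a) ^ k) ^ 2          ≤⟨ ^-monoˡ-≤ 2 ([1+m]^k≤2m^k (2 * k + a) k (m≤n⇒m≤1+n (m≤m+n _ a))) ⟩
  (2 * (2 * k + a) ^ k) ^ 2          ≡⟨ ^-distribʳ-* 2 ((2 * k + a) ^ k) 2 ⟩
  4 * ((2 * k + a) ^ k) ^ 2          ≡⟨ cong (4 *_) (trans (^-*-assoc (2 * k + a) k 2) (cong ((2 * k + a) ^_) (*-comm k 2))) ⟩
  4 * (2 * k + a) ^ (2 * k)          ≤⟨ *-monoʳ-≤ 4 ([2k+a]^2k≤4^a[2k]^2k k a) ⟩
  4 * (4 ^ a * (2 * k) ^ (2 * k))    ≡⟨ *-assoc 4 (4 ^ a) _ ⟨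
  4 * 4 ^ a * (2 * k) ^ (2 * k)      ∎
  where open ≤-Reasoning

-- The geometric mean bound

_⊕_ : {k : ℕ} → Vec Bool k → Vec Bool k → Vec Bool k
_⊕_ = zipWith _xor_

-- Translation permutes the space: on the head bit it fixes or swaps the two summands, and the tail
-- is handled by induction.
∑-shift : (k : ℕ) (c : Vec Bool k) (f : Vec Bool k → ℕ) →
  ∑ (allVecs k) (λ y → f (y ⊕ c)) ≡ ∑ (allVecs k) f
∑-shift zero    []      f = refl
∑-shift (suc k) (b ∷ c) f = begin
  ∑ (allVecs (suc k)) (λ y → f (y ⊕ (b ∷ c)))
    ≡⟨ ∑-allVecs-suc k _ ⟩
  ∑ (allVecs k) (λ v → f (b ∷ (v ⊕ c)) + f ((true xor b) ∷ (v ⊕ c)))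
    ≡⟨ ∑-shift k c (λ w → f (b ∷ w) + f ((true xor b) ∷ w)) ⟩
  ∑ (allVecs k) (λ v → f (b ∷ v) + f ((true xor b) ∷ v))
    ≡⟨ ∑-cong (allVecs k) (λ v → swap b v) ⟩
  ∑ (allVecs k) (λ v → f (false ∷ v) + f (true ∷ v))
    ≡⟨ ∑-allVecs-suc k f ⟨
  ∑ (allVecs (suc k)) f ∎
  where
  open ≡-Reasoning
  swap : ∀ b v → f (b ∷ v) + f ((true xor b) ∷ v) ≡ f (false ∷ v) + f (true ∷ v)
  swap false v = refl
  swap true  v = +-comm (f (true ∷ v)) (f (false ∷ v))

⊕-comm : {k : ℕ} (x y : Vec Bool k) → x ⊕ y ≡ y ⊕ x
⊕-comm = zipWith-comm xor-comm

⊕-assoc : {k : ℕ} (x y z : Vec Bool k) → (x ⊕ y) ⊕ z ≡ x ⊕ (y ⊕ z)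
⊕-assoc = zipWith-assoc xor-assoc

-- `zipWith _∷_ c M` is `M` with `c` as a new first column, so the first coordinate of the argument
-- decides whether `c` is added.
apply-false∷ : {ℓ u : ℕ} (c : Vec Bool ℓ) (M : Mat ℓ u) (x : Vec Bool u) →
  apply (zipWith _∷_ c M) (false ∷ x) ≡ apply M x
apply-false∷ []      []      x = refl
apply-false∷ (b ∷ c) (r ∷ M) x = cong₂ _∷_ (cong (_xor dot r x) (∧-zeroʳ b)) (apply-false∷ c M x)

apply-true∷ : {ℓ u : ℕ} (c : Vec Bool ℓ) (M : Mat ℓ u) (x : Vec Bool u) →
  apply (zipWith _∷_ c M) (true ∷ x) ≡ c ⊕ apply M x
apply-true∷ []      []      x = refl
apply-true∷ (b ∷ c) (r ∷ M) x = cong₂ _∷_ (cong (_xor dot r x) (∧-identityʳ b)) (apply-true∷ c M x)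

module GeometricMean (ℓ : ℕ) where

  N : ℕ
  N = 2 ^ ℓ

  Ys : List (Vec Bool ℓ)
  Ys = allVecs ℓ

  Z : {u : ℕ} → (Vec Bool u → Vec Bool ℓ → ℕ) → Mat ℓ u → ℕ
  Z {u} F M = ∑ Ys (λ y → ∏ (allVecs u) (λ x → F x (y ⊕ apply M x)))

  mass : {u : ℕ} → (Vec Bool u → Vec Bool ℓ → ℕ) → Vec Bool u → ℕ
  mass F x = ∑ Ys (F x)

  exposeColumn : {u : ℕ} → (Vec Bool (suc u) → Vec Bool ℓ → ℕ) → Vec Bool ℓ → Vec Bool u → Vec Bool ℓ → ℕ
  exposeColumn F c x z = F (false ∷ x) z * F (true ∷ x) (z ⊕ c)

  -- The points `0x` and `1x` are sent to `Mx` and `Mx + c`; their two factors merge into one factor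
  -- at `x`, with the translation by `c` absorbed into the function.
  Z-exposeColumn : {u : ℕ} (F : Vec Bool (suc u) → Vec Bool ℓ → ℕ) (c : Vec Bool ℓ) (M : Mat ℓ u) →
    Z F (zipWith _∷_ c M) ≡ Z (exposeColumn F c) M
  Z-exposeColumn {u} F c M = ∑-cong Ys λ y →
    trans (∏-allVecs-suc u _) (∏-cong (allVecs u) λ x →
      cong₂ _*_ (cong (λ t → F (false ∷ x) (y ⊕ t)) (apply-false∷ c M x))
                (cong (F (true ∷ x)) (trans (cong (y ⊕_) (trans (apply-true∷ c M x) (⊕-comm c _)))
                                            (sym (⊕-assoc y (apply M x) c)))))

  -- For fixed `y` the point `y ⊕ c` runs over the whole space as `c` does, so the double sum
  -- factors.
  ∑-mass-exposeColumn : {u : ℕ} (F : Vec Bool (suc u) → Vec Bool ℓ → ℕ) (x : Vec Bool u) →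
    ∑ Ys (λ c → mass (exposeColumn F c) x) ≡ mass F (false ∷ x) * mass F (true ∷ x)
  ∑-mass-exposeColumn F x = begin
    ∑ Ys (λ c → ∑ Ys (λ y → F₀ y * F₁ (y ⊕ c)))  ≡⟨ ∑-swap Ys Ys _ ⟩
    ∑ Ys (λ y → ∑ Ys (λ c → F₀ y * F₁ (y ⊕ c)))  ≡⟨ ∑-cong Ys (λ y → ∑-*ˡ (F₀ y) Ys _) ⟩
    ∑ Ys (λ y → F₀ y * ∑ Ys (λ c → F₁ (y ⊕ c)))  ≡⟨ ∑-cong Ys (λ y → cong (F₀ y *_)
                                                        (trans (∑-cong Ys (λ c → cong F₁ (⊕-comm y c))) (∑-shift ℓ y F₁))) ⟩
    ∑ Ys (λ y → F₀ y * ∑ Ys F₁)                  ≡⟨ ∑-*ʳ Ys F₀ _ ⟩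
    ∑ Ys F₀ * ∑ Ys F₁                            ∎
    where
    open ≡-Reasoning
    F₀ = F (false ∷ x)
    F₁ = F (true ∷ x)

  -- AM-GM over `c` is applied at each `x` separately; each of the `2 ^ u` points contributes one
  -- normaliser `N ^ N`.
  ∏-mass-exposeColumn : {u : ℕ} (F : Vec Bool (suc u) → Vec Bool ℓ → ℕ) →
    ∏ Ys (λ c → ∏ (allVecs u) (mass (exposeColumn F c))) * (N ^ N) ^ 2 ^ u ≤ ∏ (allVecs (suc u)) (mass F) ^ N
  ∏-mass-exposeColumn {u} F = begin
    ∏ Ys (λ c → ∏ (allVecs u) (mass (exposeColumn F c))) * (N ^ N) ^ 2 ^ u
      ≡⟨ cong₂ _*_ (∏-swap Ys (allVecs u) _) (sym (∏-allVecs-const u (N ^ N))) ⟩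
    ∏ (allVecs u) (λ x → ∏ Ys (λ c → mass (exposeColumn F c) x)) * ∏ (allVecs u) (λ _ → N ^ N)
      ≡⟨ ∏-* (allVecs u) _ _ ⟨
    ∏ (allVecs u) (λ x → ∏ Ys (λ c → mass (exposeColumn F c) x) * N ^ N)
      ≤⟨ ∏-mono (allVecs u) (λ x → am-gm ℓ _) ⟩
    ∏ (allVecs u) (λ x → ∑ Ys (λ c → mass (exposeColumn F c) x) ^ N)
      ≡⟨ ∏-cong (allVecs u) (λ x → cong (_^ N) (∑-mass-exposeColumn F x)) ⟩
    ∏ (allVecs u) (λ x → (mass F (false ∷ x) * mass F (true ∷ x)) ^ N)
      ≡⟨ ∏-^ (allVecs u) _ N ⟩
    ∏ (allVecs u) (λ x → mass F (false ∷ x) * mass F (true ∷ x)) ^ N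
      ≡⟨ cong (_^ N) (∏-allVecs-suc u (mass F)) ⟨
    ∏ (allVecs (suc u)) (mass F) ^ N ∎
    where open ≤-Reasoning

  -- With H = 2^(ℓ·u) matrices, this is ∏_M (Z(F,M)/N) ≤ (∏_x (mass F x / N))^H, cleared of denominators.
  geometric-mean-Z : (u : ℕ) (F : Vec Bool u → Vec Bool ℓ → ℕ) →
    ∏ (allMats ℓ u) (Z F) * (N ^ 2 ^ u) ^ 2 ^ (ℓ * u) ≤ (∏ (allVecs u) (mass F) * N) ^ 2 ^ (ℓ * u)
  geometric-mean-Z zero F rewrite *-zeroʳ ℓ = ≤-reflexive (begin
    ∏ (allMats ℓ 0) (Z F) * ((N * 1) * 1)   ≡⟨ cong (_* ((N * 1) * 1)) (∏-allMats-zero ℓ (Z F)) ⟩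
    -- The only matrix without columns merely translates `y`, which leaves the sum unchanged.
    Z F (replicate ℓ []) * ((N * 1) * 1)    ≡⟨ cong (_* ((N * 1) * 1)) (trans (∑-cong Ys (λ y → *-identityʳ _))
                                                  (∑-shift ℓ (apply (replicate ℓ []) []) (F []))) ⟩
    mass F [] * ((N * 1) * 1)               ≡⟨ eq (mass F []) N ⟩
    (mass F [] * 1 * N) * 1                 ∎)
    where
    open ≡-Reasoning
    eq : ∀ a n → a * ((n * 1) * 1) ≡ (a * 1 * n) * 1
    eq = solve-∀
  geometric-mean-Z (suc u) F = begin
    ∏ (allMats ℓ (suc u)) (Z F) * (N ^ 2 ^ suc u) ^ 2 ^ (ℓ * suc u)
      ≡⟨ cong₂ _*_ (trans (∏-allMats-suc ℓ u (Z F)) (∏-cong Ys (λ c → ∏-cong (allMats ℓ u) (Z-exposeColumn F c)))) powers ⟩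
    ∏ Ys P * (K ^ N * ((N ^ N) ^ 2 ^ u) ^ H)
      ≡⟨ *-assoc (∏ Ys P) (K ^ N) _ ⟨
    ∏ Ys P * K ^ N * ((N ^ N) ^ 2 ^ u) ^ H
      -- One normaliser `K` goes to each of the `N` columns `c`, as the induction hypothesis
      -- requires.
      ≡⟨ cong (λ t → ∏ Ys P * t * ((N ^ N) ^ 2 ^ u) ^ H) (∏-allVecs-const ℓ K) ⟨
    ∏ Ys P * ∏ Ys (λ _ → K) * ((N ^ N) ^ 2 ^ u) ^ H
      ≡⟨ cong (_* ((N ^ N) ^ 2 ^ u) ^ H) (∏-* Ys P _) ⟨
    ∏ Ys (λ c → P c * K) * ((N ^ N) ^ 2 ^ u) ^ H
      ≤⟨ *-monoˡ-≤ _ (∏-mono Ys (λ c → geometric-mean-Z u (exposeColumn F c))) ⟩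
    ∏ Ys (λ c → (Q c * N) ^ H) * ((N ^ N) ^ 2 ^ u) ^ H
      ≡⟨ cong (_* ((N ^ N) ^ 2 ^ u) ^ H) (∏-^ Ys _ H) ⟩
    ∏ Ys (λ c → Q c * N) ^ H * ((N ^ N) ^ 2 ^ u) ^ H
      ≡⟨ ^-distribʳ-* _ _ H ⟨
    (∏ Ys (λ c → Q c * N) * (N ^ N) ^ 2 ^ u) ^ H
      ≡⟨ cong (λ t → (t * (N ^ N) ^ 2 ^ u) ^ H) (trans (∏-* Ys Q _) (cong (∏ Ys Q *_) (∏-allVecs-const ℓ N))) ⟩
    (∏ Ys Q * N ^ N * (N ^ N) ^ 2 ^ u) ^ H
      ≡⟨ cong (_^ H) (eq (∏ Ys Q) (N ^ N) _) ⟩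
    (∏ Ys Q * (N ^ N) ^ 2 ^ u * N ^ N) ^ H
      ≤⟨ ^-monoˡ-≤ H (*-monoˡ-≤ (N ^ N) (∏-mass-exposeColumn F)) ⟩
    (D ^ N * N ^ N) ^ H
      ≡⟨ cong (_^ H) (^-distribʳ-* D N N) ⟨
    ((D * N) ^ N) ^ H
      ≡⟨ ^-*-assoc (D * N) N H ⟩
    (D * N) ^ (N * H)
      ≡⟨ cong ((D * N) ^_) count ⟨
    (D * N) ^ 2 ^ (ℓ * suc u) ∎
    where
    open ≤-Reasoning
    H = 2 ^ (ℓ * u)
    K = (N ^ 2 ^ u) ^ H
    D = ∏ (allVecs (suc u)) (mass F)
    P Q : Vec Bool ℓ → ℕ
    P c = ∏ (allMats ℓ u) (Z (exposeColumn F c))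
    Q c = ∏ (allVecs u) (mass (exposeColumn F c))
    count : 2 ^ (ℓ * suc u) ≡ N * H
    count = trans (cong (2 ^_) (*-suc ℓ u)) (^-distribˡ-+-* 2 ℓ (ℓ * u))
    exponents : ∀ a n h → 2 * a * (n * h) ≡ a * h * n + n * a * h
    exponents = solve-∀
    -- The normaliser splits into two equal halves: `K ^ N` serves the induction hypotheses, the
    -- rest serves AM-GM over the exposed column.
    powers : (N ^ 2 ^ suc u) ^ 2 ^ (ℓ * suc u) ≡ K ^ N * ((N ^ N) ^ 2 ^ u) ^ H
    powers = begin-equality
      (N ^ 2 ^ suc u) ^ 2 ^ (ℓ * suc u)            ≡⟨ ^-*-assoc N (2 ^ suc u) _ ⟩
      N ^ (2 ^ suc u * 2 ^ (ℓ * suc u))            ≡⟨ cong (λ t → N ^ (2 ^ suc u * t)) count ⟩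
      N ^ (2 * 2 ^ u * (N * H))                    ≡⟨ cong (N ^_) (exponents (2 ^ u) N H) ⟩
      N ^ (2 ^ u * H * N + N * 2 ^ u * H)          ≡⟨ ^-distribˡ-+-* N (2 ^ u * H * N) _ ⟩
      N ^ (2 ^ u * H * N) * N ^ (N * 2 ^ u * H)    ≡⟨ cong₂ _*_
        (trans (cong (_^ N) (^-*-assoc N (2 ^ u) H)) (^-*-assoc N (2 ^ u * H) N))
        (trans (cong (_^ H) (^-*-assoc N N (2 ^ u))) (^-*-assoc N (N * 2 ^ u) H)) ⟨
      K ^ N * ((N ^ N) ^ 2 ^ u) ^ H                ∎
    eq : ∀ a b c → a * b * c ≡ a * c * b
    eq = solve-∀

-- Loads as sums of Kronecker deltas

-- Recursion on bits, rather than a decision by `≡-dec`, lets this reduce once `∑-allVecs-suc`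
-- exposes a head bit.
κ : {k : ℕ} → Vec Bool k → Vec Bool k → ℕ
κ []      []      = 1
κ (a ∷ x) (b ∷ y) = if a xor b then 0 else κ x y

κ≤1 : {k : ℕ} (x y : Vec Bool k) → κ x y ≤ 1
κ≤1 []          []          = ≤-refl
κ≤1 (false ∷ x) (false ∷ y) = κ≤1 x y
κ≤1 (false ∷ x) (true  ∷ y) = z≤n
κ≤1 (true  ∷ x) (false ∷ y) = z≤n
κ≤1 (true  ∷ x) (true  ∷ y) = κ≤1 x y

κ-refl : {k : ℕ} (x : Vec Bool k) → κ x x ≡ 1
κ-refl []          = refl
κ-refl (false ∷ x) = κ-refl x
κ-refl (true  ∷ x) = κ-refl x

κ-≢ : {k : ℕ} (x y : Vec Bool k) → x ≢ y → κ x y ≡ 0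
κ-≢ []          []          x≢y = contradiction refl x≢y
κ-≢ (false ∷ x) (false ∷ y) x≢y = κ-≢ x y (λ eq → x≢y (cong (false ∷_) eq))
κ-≢ (false ∷ x) (true  ∷ y) x≢y = refl
κ-≢ (true  ∷ x) (false ∷ y) x≢y = refl
κ-≢ (true  ∷ x) (true  ∷ y) x≢y = κ-≢ x y (λ eq → x≢y (cong (true ∷_) eq))

-- Over 𝔽₂ every vector is its own negative, so `y ⊕ x` vanishes exactly when `x` equals `y`.
κ-⊕ : {k : ℕ} (x y : Vec Bool k) → κ (y ⊕ x) (replicate k false) ≡ κ x y
κ-⊕ []          []          = refl
κ-⊕ (false ∷ x) (false ∷ y) = κ-⊕ x y
κ-⊕ (false ∷ x) (true  ∷ y) = refl
κ-⊕ (true  ∷ x) (false ∷ y) = refl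
κ-⊕ (true  ∷ x) (true  ∷ y) = κ-⊕ x y

∑-κ : (k : ℕ) (s : Vec Bool k) (g : Vec Bool k → ℕ) → ∑ (allVecs k) (λ x → κ x s * g x) ≡ g s
∑-κ zero    []          g = trans (+-identityʳ _) (*-identityˡ _)
∑-κ (suc k) (false ∷ s) g = trans (∑-allVecs-suc k _)
  (trans (∑-cong (allVecs k) (λ v → +-identityʳ _)) (∑-κ k s (λ v → g (false ∷ v))))
∑-κ (suc k) (true  ∷ s) g = trans (∑-allVecs-suc k _) (∑-κ k s (λ v → g (true ∷ v)))

-- Serves as the indicator of `S` when `S` has no repetitions. As a sum over `S` it lets sums over
-- the whole space be exchanged for sums over `S`.
multiplicity : {k : ℕ} → List (Vec Bool k) → Vec Bool k → ℕ
multiplicity S x = ∑ S (κ x)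

∑-multiplicity : {k : ℕ} (S : List (Vec Bool k)) (g : Vec Bool k → ℕ) →
  ∑ (allVecs k) (λ x → multiplicity S x * g x) ≡ ∑ S g
∑-multiplicity {k} S g = begin
  ∑ (allVecs k) (λ x → ∑ S (κ x) * g x)          ≡⟨ ∑-cong (allVecs k) (λ x → ∑-*ʳ S (κ x) (g x)) ⟨
  ∑ (allVecs k) (λ x → ∑ S (λ s → κ x s * g x))  ≡⟨ ∑-swap (allVecs k) S _ ⟩
  ∑ S (λ s → ∑ (allVecs k) (λ x → κ x s * g x))  ≡⟨ ∑-cong S (λ s → ∑-κ k s g) ⟩
  ∑ S g                                          ∎
  where open ≡-Reasoning

multiplicity-∉ : {k : ℕ} {x : Vec Bool k} {S : List (Vec Bool k)} → All (x ≢_) S → multiplicity S x ≡ 0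
multiplicity-∉ []           = refl
multiplicity-∉ (x≢s ∷ x≢S) = cong₂ _+_ (κ-≢ _ _ x≢s) (multiplicity-∉ x≢S)

multiplicity≤1 : {k : ℕ} {S : List (Vec Bool k)} → Unique S → (x : Vec Bool k) → multiplicity S x ≤ 1
multiplicity≤1                []          x = z≤n
multiplicity≤1 {S = s ∷ S} (s≢S ∷ uniq) x with ≡-dec _≟B_ x s
... | yes refl rewrite κ-refl x | multiplicity-∉ s≢S = ≤-refl
... | no  x≢s  rewrite κ-≢ x s x≢s = multiplicity≤1 uniq x

load≡∑κ : {ℓ u : ℕ} (M : Mat ℓ u) (S : List (Vec Bool u)) (y : Vec Bool ℓ) →
  load M S y ≡ ∑ S (λ s → κ (apply M s) y)
load≡∑κ M []      y = refl
load≡∑κ M (s ∷ S) y with ≡-dec _≟B_ (apply M s) y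
... | yes refl rewrite κ-refl (apply M s) = cong suc (load≡∑κ M S (apply M s))
... | no  ≢y   rewrite κ-≢ (apply M s) y ≢y = load≡∑κ M S y

-- Makes a power with exponent 0 or 1 affine in the exponent, so that it can be summed against `κ`.
[1+a]^e : ∀ a e → e ≤ 1 → suc a ^ e ≡ 1 + e * a
[1+a]^e a zero          _         = refl
[1+a]^e a (suc zero)    _         = cong suc (trans (*-identityʳ a) (sym (*-identityˡ a)))
[1+a]^e a (suc (suc _)) (s≤s ())

-- The maximum is attained by some term. On the empty list the default 0 would give 1 on the left
-- and 0 on the right; the recursion therefore stops at singletons.
^-max≤∑ : {A : Set} (b : ℕ) (xs : List A) (f : A → ℕ) → 1 ≤ length xs →
  b ^ foldr _⊔_ 0 (map f xs) ≤ ∑ xs (λ x → b ^ f x)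
^-max≤∑ b (x ∷ [])     f _ = ≤-reflexive (trans (cong (b ^_) (⊔-identityʳ (f x))) (sym (+-identityʳ _)))
^-max≤∑ b (x ∷ y ∷ ys) f _ = ≤-trans (^-⊔ (f x) _) (+-monoʳ-≤ (b ^ f x) (^-max≤∑ b (y ∷ ys) f (s≤s z≤n)))
  where
  ^-⊔ : ∀ p q → b ^ (p ⊔ q) ≤ b ^ p + b ^ q
  ^-⊔ p q with ⊔-sel p q
  ... | inj₁ eq rewrite eq = m≤m+n (b ^ p) (b ^ q)
  ... | inj₂ eq rewrite eq = m≤n+m (b ^ q) (b ^ p)

-- The potential attached to `S`.

module Potential (a u : ℕ) (S : List (Vec Bool u)) where

  ℓ : ℕ
  ℓ = suc a

  open GeometricMean ℓ

  F : Vec Bool u → Vec Bool ℓ → ℕ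
  F x z = ℓ ^ (multiplicity S x * κ z (replicate ℓ false))

  -- The product over `x` adds up the exponents, and their sum counts the points of `S` with
  -- `y ⊕ apply M x` zero, which is the load at `y`.
  Z-F : (M : Mat ℓ u) → Z F M ≡ ∑ Ys (λ y → ℓ ^ load M S y)
  Z-F M = ∑-cong Ys λ y → trans (∏-base-^ ℓ (allVecs u) _) (cong (ℓ ^_)
    (trans (∑-multiplicity S (λ x → κ (y ⊕ apply M x) (replicate ℓ false)))
    (trans (∑-cong S (λ s → κ-⊕ (apply M s) y)) (sym (load≡∑κ M S y)))))

  ℓ^maxLoad≤Z : (M : Mat ℓ u) → ℓ ^ maxLoad M S ≤ Z F M
  ℓ^maxLoad≤Z M = subst (ℓ ^ maxLoad M S ≤_) (sym (Z-F M)) (^-max≤∑ ℓ Ys (load M S) nonempty)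
    where
    nonempty : 1 ≤ length Ys
    nonempty = subst (1 ≤_) (trans (sym (trans (∑-allVecs-const ℓ 1) (*-identityˡ N))) (∑-one Ys)) (m^n>0 2 ℓ)

  -- Multiplying over all matrices adds the maximum loads in the exponent, so a geometric mean
  -- bounds the expectation directly.
  ℓ^totalMaxLoad≤∏Z : ℓ ^ totalMaxLoad ℓ u S ≤ ∏ (allMats ℓ u) (Z F)
  ℓ^totalMaxLoad≤∏Z = ≤-trans (≤-reflexive (sym (∏-base-^ ℓ (allMats ℓ u) _))) (∏-mono (allMats ℓ u) ℓ^maxLoad≤Z)

  -- The mass is `N` off `S` and `N + a` on `S`. Placing the multiplicity in exponents covers both
  -- cases by one formula that can be multiplied over all `x`.
  mass-F : (x : Vec Bool u) → multiplicity S x ≤ 1 →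
    mass F x * N ^ multiplicity S x ≡ N * (N + a) ^ multiplicity S x
  mass-F x w≤1 with multiplicity S x
  ... | zero = cong (_* 1) (trans (∑-allVecs-const ℓ 1) (*-identityˡ N))
  ... | suc (suc _) with s≤s () ← w≤1
  ... | suc zero = begin
    -- Every `z` contributes 1, and the zero vector contributes `a` more.
    ∑ Ys (λ z → ℓ ^ (1 * κ z 0v)) * (N * 1)        ≡⟨ cong (_* (N * 1)) (∑-cong Ys λ z →
                                                       trans (cong (ℓ ^_) (*-identityˡ (κ z 0v))) ([1+a]^e a _ (κ≤1 z 0v))) ⟩
    ∑ Ys (λ z → 1 + κ z 0v * a) * (N * 1)          ≡⟨ cong (_* (N * 1)) (∑-+ Ys (λ _ → 1) _) ⟩
    (∑ Ys (λ _ → 1) + ∑ Ys (λ z → κ z 0v * a)) * (N * 1)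
      ≡⟨ cong (_* (N * 1)) (cong₂ _+_ (trans (∑-allVecs-const ℓ 1) (*-identityˡ N)) (∑-κ ℓ 0v (λ _ → a))) ⟩
    (N + a) * (N * 1)                              ≡⟨ eq N a ⟩
    N * ((N + a) * 1)                              ∎
    where
    open ≡-Reasoning
    0v = replicate ℓ false
    eq : ∀ n a → (n + a) * (n * 1) ≡ n * ((n + a) * 1)
    eq = solve-∀

  ∏-base-multiplicity : (b : ℕ) → ∏ (allVecs u) (λ x → b ^ multiplicity S x) ≡ b ^ length S
  ∏-base-multiplicity b = trans (∏-base-^ b (allVecs u) _) (cong (b ^_)
    (trans (∑-cong (allVecs u) (λ x → sym (*-identityʳ (multiplicity S x))))
    (trans (∑-multiplicity S (λ _ → 1)) (∑-one S))))

  ∏-mass-F : Unique S → ∏ (allVecs u) (mass F) * N ^ length S ≡ N ^ 2 ^ u * (N + a) ^ length S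
  ∏-mass-F uniq = begin
    ∏ (allVecs u) (mass F) * N ^ length S
      ≡⟨ cong (∏ (allVecs u) (mass F) *_) (∏-base-multiplicity N) ⟨
    ∏ (allVecs u) (mass F) * ∏ (allVecs u) (λ x → N ^ multiplicity S x)
      ≡⟨ ∏-* (allVecs u) _ _ ⟨
    ∏ (allVecs u) (λ x → mass F x * N ^ multiplicity S x)
      ≡⟨ ∏-cong (allVecs u) (λ x → mass-F x (multiplicity≤1 uniq x)) ⟩
    ∏ (allVecs u) (λ x → N * (N + a) ^ multiplicity S x)
      ≡⟨ ∏-* (allVecs u) _ _ ⟩
    ∏ (allVecs u) (λ _ → N) * ∏ (allVecs u) (λ x → (N + a) ^ multiplicity S x)
      ≡⟨ cong₂ _*_ (∏-allVecs-const u N) (∏-base-multiplicity (N + a)) ⟩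
    N ^ 2 ^ u * (N + a) ^ length S ∎
    where open ≡-Reasoning

  ∏-mass-F≤ : Unique S → length S ≡ N → ∏ (allVecs u) (mass F) ≤ N ^ 2 ^ u * 4 ^ a
  ∏-mass-F≤ uniq len = *-cancelʳ-≤ _ _ (N ^ N) {{m^n≢0 N N {{m^n≢0 2 ℓ}}}} (begin
    ∏ (allVecs u) (mass F) * N ^ N  ≡⟨ subst (λ t → ∏ (allVecs u) (mass F) * N ^ t ≡ N ^ 2 ^ u * (N + a) ^ t) len (∏-mass-F uniq) ⟩
    -- `N` is `2 * 2 ^ a` by computation, since `ℓ` is `suc a`; hence the exponential bound applies
    -- with `k = 2 ^ a`.
    N ^ 2 ^ u * (N + a) ^ N         ≤⟨ *-monoʳ-≤ (N ^ 2 ^ u) ([2k+a]^2k≤4^a[2k]^2k (2 ^ a) a) ⟩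
    N ^ 2 ^ u * (4 ^ a * N ^ N)     ≡⟨ *-assoc (N ^ 2 ^ u) (4 ^ a) (N ^ N) ⟨
    N ^ 2 ^ u * 4 ^ a * N ^ N       ∎)
    where open ≤-Reasoning

  ℓ^totalMaxLoad≤ : Unique S → length S ≡ N → ℓ ^ totalMaxLoad ℓ u S ≤ (4 ^ a * N) ^ 2 ^ (ℓ * u)
  ℓ^totalMaxLoad≤ uniq len = *-cancelʳ-≤ _ _ (K ^ H) {{m^n≢0 K H {{m^n≢0 N (2 ^ u) {{m^n≢0 2 ℓ}}}}}} (begin
    ℓ ^ totalMaxLoad ℓ u S * K ^ H      ≤⟨ *-monoˡ-≤ (K ^ H) ℓ^totalMaxLoad≤∏Z ⟩
    ∏ (allMats ℓ u) (Z F) * K ^ H       ≤⟨ geometric-mean-Z u F ⟩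
    (∏ (allVecs u) (mass F) * N) ^ H    ≤⟨ ^-monoˡ-≤ H (*-monoˡ-≤ N (∏-mass-F≤ uniq len)) ⟩
    (K * 4 ^ a * N) ^ H                 ≡⟨ cong (_^ H) (eq K (4 ^ a) N) ⟩
    (4 ^ a * N * K) ^ H                 ≡⟨ ^-distribʳ-* (4 ^ a * N) K H ⟩
    (4 ^ a * N) ^ H * K ^ H             ∎)
    where
    open ≤-Reasoning
    H = 2 ^ (ℓ * u)
    K = N ^ 2 ^ u
    eq : ∀ k p n → k * p * n ≡ p * n * k
    eq = solve-∀

-- With `log n = ℓ` and `2 ^ (ℓ * u)` maps, base-2 logarithms turn this into `𝔼 · log ℓ ≤ 16 ℓ`. For
-- `ℓ ≥ 2` this is the stated bound; at `ℓ = 1` the exponentiated form avoids division by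
-- `log log n = 0`.
theorem1p1 : (u ℓ : ℕ) → 1 ≤ ℓ → ℓ ≤ u →
    (S : List (Vec Bool u)) → Unique S → length S ≡ 2 ^ ℓ →
    ℓ ^ totalMaxLoad ℓ u S ≤ 2 ^ (16 * ℓ * 2 ^ (ℓ * u))
theorem1p1 u (suc a) _ _ S uniq len = begin
  ℓ ^ totalMaxLoad ℓ u S       ≤⟨ Potential.ℓ^totalMaxLoad≤ a u S uniq len ⟩
  (4 ^ a * 2 ^ ℓ) ^ H          ≡⟨ cong (λ t → (t * 2 ^ ℓ) ^ H) (^-*-assoc 2 2 a) ⟩
  (2 ^ (2 * a) * 2 ^ ℓ) ^ H    ≡⟨ cong (_^ H) (^-distribˡ-+-* 2 (2 * a) ℓ) ⟨
  (2 ^ (2 * a + ℓ)) ^ H        ≤⟨ ^-monoˡ-≤ H (^-monoʳ-≤ 2 exponent) ⟩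
  (2 ^ (16 * ℓ)) ^ H           ≡⟨ ^-*-assoc 2 (16 * ℓ) H ⟩
  2 ^ (16 * ℓ * H)             ∎
  where
  open ≤-Reasoning
  ℓ = suc a
  H = 2 ^ (ℓ * u)
  -- The argument yields the exponent `3 * a + 1`; the term `13 * a + 15` is the slack up to
  -- `16 * ℓ`.
  eq : ∀ a → 2 * a + suc a + (13 * a + 15) ≡ 16 * suc a
  eq = solve-∀
  exponent : 2 * a + ℓ ≤ 16 * ℓ
  exponent = subst (2 * a + ℓ ≤_) (eq a) (m≤m+n _ (13 * a + 15))
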